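{- The function $\mathtt{next\_state}:\mathtt{State}\to\mathtt{option}\ \mathtt{State}$ is a strategy, i.e. (i) $\mathtt{next\_state}\ \mathtt{fail}=\mathtt{None}$; (ii) for all states $s$, if $\mathtt{next\_state}\ s=\mathtt{None}$ then $s$ is final in the base DPLL system; (iii) for all states $s,s'$, if $\mathtt{next\_state}\ s=\mathtt{Some}\ s'$ then $s\Longrightarrow^+s'$, where $\Longrightarrow^+$ is the transitive closure of the classical DPLL transition relation.
   Context: Fix a finite set $P$ of atoms. A literal is an atom $p\in P$ or its negation $\neg p$, with $\neg\neg p=p$. A clause is a finite list of literals, read as their disjunction; a formula (CNF) is a finite list of clauses, read as their conjunction. A partial assignment is an arbitrary finite list of literals, each annotated either as a decision literal (written $l^d$) or as a propagated literal (written $l$). New literals are appended on the right, and $mn$ denotes concatenation. Evaluation takes values in $\{T,F,U\}$ and ignores annotations; the rightmost occurrence of an atom takes precedence: $[\![l]\!]_m=T$ if the rightmost occurrence in $m$ of the atom of $l$ is as $l$, $F$ if it is as $\neg l$, and $U$ if the atom does not occur in $m$. For a clause $c$: $[\![c]\!]_m=T$ if some literal of $c$ evaluates to $T$, $F$ if all literals of $c$ evaluate to $F$, else $U$. "True/false/undefined in $m$" means value $T/F/U$. A state is either the distinguished state $\mathtt{fail}$ or a pair $m\parallel f$ of a partial assignment and a formula. The classical DPLL system is the relation $\Longrightarrow$ on states given by the following rules (order within clauses and formulas being irrelevant for reading $c\lor l$, $f\land c$): UnitPropagate: $m\parallel f\land(c\lor l)\Longrightarrow m\,l\parallel f\land(c\lor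 l)$ if $c$ is false in $m$ and $l$ is undefined in $m$. Decide: $m\parallel f\Longrightarrow m\,l^d\parallel f$ if $l$ or $\neg l$ occurs in a clause of $f$ and $l$ is undefined in $m$. Fail: $m\parallel f\land c\Longrightarrow\mathtt{fail}$ if $c$ is false in $m$ and $m$ contains no decision literals. Backtrack: $m\,l^d\,n\parallel f\land c\Longrightarrow m\,\neg l\parallel f\land c$ if $c$ is false in $m\,l^d\,n$ and $n$ contains no decision literals (the new $\neg l$ is propagated). Pure: $m\parallel f\Longrightarrow m\,l\parallel f$ if $l$ occurs in a clause of $f$, $\neg l$ occurs in no clause of $f$, and $l$ is undefined in $m$. The base DPLL system consists of only the rules Decide, Fail and Backtrack. A state is final in a system if no rule of the system applies to it. The function $\mathtt{next\_state}$: $\mathtt{next\_state}\ \mathtt{fail}=\mathtt{None}$. On $m\parallel f$: (1) If some clause of $f$ is false in $m$ (conflict): if $m$ contains no decision literal, return $\mathtt{Some}\ \mathtt{fail}$; otherwise write $m=m'\,l^d\,n$ with $n$ free of decision literals and return $\mathtt{Some}\,(m'\,\neg l\parallel f)$ with $\neg l$ propagated. (2) Otherwise, if some clause of $f$ is unit under $m$, i.e. of the form $c\lor l$ with $c$ false in $m$ and $l$ undefined in $m$, pick one such (by a fixed search) and return $\mathtt{Some}\,(m\,l\parallel f)$ with $l$ propagated. (3) Otherwise, if some literal occurring in $f$ is undefined in $m$, pick one such $l$ (by a fixed search) and return $\mathtt{Some}\,(m\,l^d\parallel f)$. (4) Otherwise return $\mathtt{None}$. -}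

module Defs where

open import Data.Bool.Base using (if_then_else_)
open import Data.Fin.Base using (Fin)
import Data.Fin.Properties as Fin
open import Data.List.Base using (List; []; _∷_; _++_; _∷ʳ_; concat)
open import Data.List.Membership.Propositional using (_∈_; _∉_; find; lose)
open import Data.List.Membership.Propositional.Properties using (∈-concat⁺′; ∈-concat⁻′)
open import Data.List.Relation.Binary.Permutation.Propositional
  using (_↭_; prep; ↭-refl; ↭-sym; ↭-trans; swap)
open import Data.List.Relation.Binary.Permutation.Propositional.Properties
  using (∈-resp-↭; Any-resp-↭; All-resp-↭; drop-∷)
open import Data.List.Relation.Unary.All using (all?)
open import Data.List.Relation.Unary.Any using (Any; any?; here; there; _─_)
open import Data.Maybe.Base as Maybe using (Maybe; just; nothing; _<∣>_)
open import Data.Nat.Base using (ℕ)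
open import Data.Product.Base using (Σ; ∃-syntax; _×_; _,_)
open import Data.Sum.Base using (_⊎_)
open import Relation.Binary.Construct.Closure.Transitive using (TransClosure)
open import Relation.Binary.Definitions using (DecidableEquality)
open import Relation.Binary.PropositionalEquality.Core using (_≡_; refl)
open import Relation.Nullary using (¬_; Dec; yes; no; does; contradiction; map′; _×-dec_)

-- The finite set of atoms is Fin n throughout.

data Literal (n : ℕ) : Set where
  pos neg : Fin n → Literal n

infix 9 ~_
infix 4 _≟ˡ_ _≟ᵛ_

~_ : ∀ {n} → Literal n → Literal n
~ pos p = neg p
~ neg p = pos p

_≟ˡ_ : ∀ {n} → DecidableEquality (Literal n)
pos p ≟ˡ pos q = map′ (λ { refl → refl }) (λ { refl → refl }) (p Fin.≟ q)
pos p ≟ˡ neg q = no λ ()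
neg p ≟ˡ pos q = no λ ()
neg p ≟ˡ neg q = map′ (λ { refl → refl }) (λ { refl → refl }) (p Fin.≟ q)

Clause : ℕ → Set
Clause n = List (Literal n)

Formula : ℕ → Set
Formula n = List (Clause n)

Occurs : ∀ {n} → Literal n → Formula n → Set
Occurs l f = ∃[ c ] c ∈ f × l ∈ c

data Annotated (n : ℕ) : Set where
  decision propagated : Literal n → Annotated n

literal : ∀ {n} → Annotated n → Literal n
literal (decision l)   = l
literal (propagated l) = l

-- Listed from left to right, so the newest literal is the last element.
Assignment : ℕ → Set
Assignment n = List (Annotated n)

NoDecision : ∀ {n} → Assignment n → Set
NoDecision m = ∀ l → decision l ∉ m

data Value : Set where
  T F U : Value

_≟ᵛ_ : DecidableEquality Value
T ≟ᵛ T = yes refl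
T ≟ᵛ F = no λ ()
T ≟ᵛ U = no λ ()
F ≟ᵛ T = no λ ()
F ≟ᵛ F = yes refl
F ≟ᵛ U = no λ ()
U ≟ᵛ T = no λ ()
U ≟ᵛ F = no λ ()
U ≟ᵛ U = yes refl

-- The tail is consulted first, so the rightmost occurrence of the atom of l
-- determines the value.
⟦_⟧ˡ : ∀ {n} → Literal n → Assignment n → Value
⟦ l ⟧ˡ []      = U
⟦ l ⟧ˡ (a ∷ m) with ⟦ l ⟧ˡ m
... | T = T
... | F = F
... | U = if does (literal a ≟ˡ l) then T
          else if does (literal a ≟ˡ ~ l) then F
          else U

⟦_⟧ᶜ : ∀ {n} → Clause n → Assignment n → Value
⟦ c ⟧ᶜ m =
  if does (any? (λ l → ⟦ l ⟧ˡ m ≟ᵛ T) c) then T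
  else if does (all? (λ l → ⟦ l ⟧ˡ m ≟ᵛ F) c) then F
  else U

infix 4 _∥_

data State (n : ℕ) : Set where
  fail : State n
  _∥_  : Assignment n → Formula n → State n

-- Some clause of f has the form c ∨ l with c false and l undefined in m.
-- The permutation expresses that order within clauses is irrelevant; c keeps
-- any further copies of l.
Unit : ∀ {n} → Assignment n → Formula n → Literal n → Set
Unit m f l =
  ∃[ d ] ∃[ c ] d ∈ f × d ↭ l ∷ c × ⟦ c ⟧ᶜ m ≡ F × ⟦ l ⟧ˡ m ≡ U

data Rule : Set where
  UnitPropagate Decide Fail Backtrack Pure : Rule

-- A formula f ∧ c, read up to the order of its clauses, is a formula f
-- together with a proof of c ∈ f.
data Step {n : ℕ} : Rule → State n → State n → Set where

  unitPropagate : ∀ {m f l} →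
    Unit m f l →
    Step UnitPropagate (m ∥ f) (m ∷ʳ propagated l ∥ f)

  decide : ∀ {m f l} →
    Occurs l f ⊎ Occurs (~ l) f →
    ⟦ l ⟧ˡ m ≡ U →
    Step Decide (m ∥ f) (m ∷ʳ decision l ∥ f)

  fail : ∀ {m f c} →
    c ∈ f →
    ⟦ c ⟧ᶜ m ≡ F →
    NoDecision m →
    Step Fail (m ∥ f) fail

  backtrack : ∀ {m l k f c} →
    c ∈ f →
    ⟦ c ⟧ᶜ (m ++ decision l ∷ k) ≡ F →
    NoDecision k →
    Step Backtrack (m ++ decision l ∷ k ∥ f) (m ∷ʳ propagated (~ l) ∥ f)

  pure : ∀ {m f l} →
    Occurs l f →
    ¬ Occurs (~ l) f →
    ⟦ l ⟧ˡ m ≡ U →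
    Step Pure (m ∥ f) (m ∷ʳ propagated l ∥ f)

infix 3 _⟹_ _⟹⁺_

_⟹_ : ∀ {n} → State n → State n → Set
s ⟹ s′ = ∃[ r ] Step r s s′

_⟹⁺_ : ∀ {n} → State n → State n → Set
_⟹⁺_ = TransClosure _⟹_

BaseStep : ∀ {n} → State n → State n → Set
BaseStep s s′ = ∃[ r ] r ∈ (Decide ∷ Fail ∷ Backtrack ∷ []) × Step r s s′

Final : ∀ {n} → (State n → State n → Set) → State n → Set
Final _⟶_ s = ∀ s′ → ¬ (s ⟶ s′)

record IsStrategy {n : ℕ} (next : State n → Maybe (State n)) : Set where
  field
    next-fail    : next fail ≡ nothing
    next-nothing : ∀ s → next s ≡ nothing → Final BaseStep s
    next-just    : ∀ s s′ → next s ≡ just s′ → s ⟹⁺ s′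

UndefinedIn : ∀ {n} → Assignment n → Formula n → Literal n → Set
UndefinedIn m f l = Occurs l f × ⟦ l ⟧ˡ m ≡ U

-- The fixed searches used by next-state.  Which literal is picked when there
-- are several is left open; see leftmost for an instance.
record Search (n : ℕ) : Set where
  field
    findUnit           : Assignment n → Formula n → Maybe (Literal n)
    findUnit-just      : ∀ m f l → findUnit m f ≡ just l → Unit m f l
    findUnit-nothing   : ∀ m f → findUnit m f ≡ nothing → ∀ l → ¬ Unit m f l

    findUndefined         : Assignment n → Formula n → Maybe (Literal n)
    findUndefined-just    : ∀ m f l → findUndefined m f ≡ just l → UndefinedIn m f l
    findUndefined-nothing : ∀ m f → findUndefined m f ≡ nothing → ∀ l → ¬ UndefinedIn m f l

-- just (m′ , l , k) stands for the decomposition m′ lᵈ k at the rightmost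
-- decision literal.
splitLastDecision : ∀ {n} → Assignment n → Maybe (Assignment n × Literal n × Assignment n)
splitLastDecision []      = nothing
splitLastDecision (a ∷ m) with splitLastDecision m
... | just (m′ , l , k) = just (a ∷ m′ , l , k)
... | nothing with a
...   | decision l   = just ([] , l , m)
...   | propagated _ = nothing

resolveConflict : ∀ {n} → Assignment n → Formula n → State n
resolveConflict m f with splitLastDecision m
... | nothing           = fail
... | just (m′ , l , _) = m′ ∷ʳ propagated (~ l) ∥ f

next-state : ∀ {n} → Search n → State n → Maybe (State n)
next-state search fail    = nothing
next-state search (m ∥ f) =
  if does (any? (λ c → ⟦ c ⟧ᶜ m ≟ᵛ F) f)
  then just (resolveConflict m f)
  else (Maybe.map (λ l → m ∷ʳ propagated l ∥ f) (findUnit m f)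
        <∣> Maybe.map (λ l → m ∷ʳ decision l ∥ f) (findUndefined m f))
  where open Search search

-- The search that inspects the literals of the formula from left to right.

private

  clauseFalse-↭ : ∀ {n} (m : Assignment n) {c c′ : Clause n} →
                  c ↭ c′ → ⟦ c ⟧ᶜ m ≡ F → ⟦ c′ ⟧ᶜ m ≡ F
  clauseFalse-↭ m {c} {c′} p eq
    with any? (λ l → ⟦ l ⟧ˡ m ≟ᵛ T) c | all? (λ l → ⟦ l ⟧ˡ m ≟ᵛ F) c
       | any? (λ l → ⟦ l ⟧ˡ m ≟ᵛ T) c′ | all? (λ l → ⟦ l ⟧ˡ m ≟ᵛ F) c′
  ... | no ¬t | yes _ | yes t | _     = contradiction (Any-resp-↭ (↭-sym p) t) ¬t
  ... | no _  | yes _ | no _  | yes _ = refl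
  ... | no _  | yes a | no _  | no ¬a = contradiction (All-resp-↭ p a) ¬a

  ↭-remove : ∀ {A : Set} {x : A} {xs : List A} (p : x ∈ xs) → xs ↭ x ∷ (xs ─ p)
  ↭-remove (here refl) = ↭-refl
  ↭-remove {xs = y ∷ _} (there p) =
    ↭-trans (prep y (↭-remove p)) (swap y _ ↭-refl)

  unit? : ∀ {n} (m : Assignment n) (f : Formula n) (l : Literal n) → Dec (Unit m f l)
  unit? m f l = map′ to from (any? inClause? f ×-dec (⟦ l ⟧ˡ m ≟ᵛ U))
    where
    InClause : Clause _ → Set
    InClause d = Σ (l ∈ d) λ p → ⟦ d ─ p ⟧ᶜ m ≡ F

    inClause? : ∀ d → Dec (InClause d)
    inClause? d with any? (l ≟ˡ_) d
    ... | no l∉d = no λ { (p , _) → l∉d p }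
    ... | yes p  = map′ (p ,_)
      (λ { (q , eq) → clauseFalse-↭ m (drop-∷ (↭-trans (↭-sym (↭-remove q)) (↭-remove p))) eq })
      (⟦ d ─ p ⟧ᶜ m ≟ᵛ F)

    to : Any InClause f × ⟦ l ⟧ˡ m ≡ U → Unit m f l
    to (a , u) with find a
    ... | d , d∈f , p , eq = d , (d ─ p) , d∈f , ↭-remove p , eq , u

    from : Unit m f l → Any InClause f × ⟦ l ⟧ˡ m ≡ U
    from (d , c , d∈f , d↭lc , eq , u) = lose d∈f (p , eq′) , u
      where
      p   = ∈-resp-↭ (↭-sym d↭lc) (here refl)
      eq′ = clauseFalse-↭ m (drop-∷ (↭-trans (↭-sym d↭lc) (↭-remove p))) eq

  first : ∀ {A : Set} {P : A → Set} {xs : List A} → Dec (Any P xs) → Maybe A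
  first (yes a) = let (x , _) = find a in just x
  first (no _)  = nothing

  first-just : ∀ {A : Set} {P : A → Set} {xs : List A} (d : Dec (Any P xs)) {x} →
               first d ≡ just x → x ∈ xs × P x
  first-just (yes a) refl = let (_ , x∈xs , px) = find a in x∈xs , px

  first-nothing : ∀ {A : Set} {P : A → Set} {xs : List A} (d : Dec (Any P xs)) →
                  first d ≡ nothing → ¬ Any P xs
  first-nothing (no ¬a) _ = ¬a

leftmost : ∀ {n} → Search n
leftmost = record
  { findUnit              = λ m f → first (any? (unit? m f) (concat f))
  ; findUnit-just         = λ m f l eq →
      let (_ , u) = first-just (any? (unit? m f) (concat f)) eq in u
  ; findUnit-nothing      = λ m f eq l u@(d , c , d∈f , d↭lc , _) →
      first-nothing (any? (unit? m f) (concat f)) eq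
        (lose (∈-concat⁺′ (∈-resp-↭ (↭-sym d↭lc) (here refl)) d∈f) u)
  ; findUndefined         = λ m f → first (any? (λ l → ⟦ l ⟧ˡ m ≟ᵛ U) (concat f))
  ; findUndefined-just    = λ m f l eq →
      let (l∈ , u)          = first-just (any? (λ l → ⟦ l ⟧ˡ m ≟ᵛ U) (concat f)) eq
          (c , l∈c , c∈f) = ∈-concat⁻′ f l∈
      in (c , c∈f , l∈c) , u
  ; findUndefined-nothing = λ { m f eq l ((c , c∈f , l∈c) , u) →
      first-nothing (any? (λ l → ⟦ l ⟧ˡ m ≟ᵛ U) (concat f)) eq
        (lose (∈-concat⁺′ l∈c c∈f) u) }
  }

{-# OPTIONS --safe #-}
module Submission where

open import Defs
open import Data.List.Base using ([]; _∷_; _++_)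
open import Data.List.Membership.Propositional using (_∈_; find; lose)
open import Data.List.Relation.Unary.Any using (any?; there)
open import Data.Maybe.Base using (Maybe; just; nothing)
open import Data.Nat.Base using (ℕ)
open import Data.Product.Base using (_×_; _,_)
open import Data.Sum.Base using (inj₁; inj₂)
open import Relation.Binary.Construct.Closure.Transitive using ([_])
open import Relation.Binary.PropositionalEquality using (_≡_; refl; cong; trans)
open import Relation.Nullary using (yes; no; contradiction)

-- Each branch of `next-state` is a single rule application: a conflict gives Fail or Backtrack,
-- depending on whether the assignment has a decision (`resolveConflict-step`); a unit literal gives
-- UnitPropagate; an undefined literal gives Decide. If no branch fires, no clause is false, which
-- blocks Fail and Backtrack, and every literal of the formula is defined, which blocks Decide. For
-- Decide on `l` when only `~ l` is known to occur, `~-undefined` transfers undefinedness to the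
-- complement.

~-involutive : ∀ {n} (l : Literal n) → ~ ~ l ≡ l
~-involutive (pos p) = refl
~-involutive (neg p) = refl

~-undefined : ∀ {n} (l : Literal n) m → ⟦ l ⟧ˡ m ≡ U → ⟦ ~ l ⟧ˡ m ≡ U
~-undefined l []      _  = refl
~-undefined l (a ∷ m) eq with ⟦ l ⟧ˡ m in tail-eq
... | U rewrite ~-undefined l m tail-eq
  -- Evaluating `~ l` tests the head against `~ l` and then `~ ~ l`, which does not reduce to `l`
  -- for a variable `l`. The omitted cases contradict `eq`.
  with literal a ≟ˡ l | literal a ≟ˡ ~ l | literal a ≟ˡ ~ ~ l
... | no a≢l | no _ | yes a≡~~l = contradiction (trans a≡~~l (~-involutive l)) a≢l
... | no _   | no _ | no _      = refl

-- Computed from the result of the split, so that a `with` on that result also selects the matching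
-- property.
SplitSpec : ∀ {n} → Assignment n → Maybe (Assignment n × Literal n × Assignment n) → Set
SplitSpec m nothing             = NoDecision m
SplitSpec m (just (m′ , l , k)) = m ≡ m′ ++ decision l ∷ k × NoDecision k

splitLastDecision-spec : ∀ {n} (m : Assignment n) → SplitSpec m (splitLastDecision m)
splitLastDecision-spec []      = λ _ ()
splitLastDecision-spec (a ∷ m) with splitLastDecision m | splitLastDecision-spec m
... | just _  | m≡ , noDec = cong (a ∷_) m≡ , noDec
... | nothing | noDec with a
...   | decision _   = refl , noDec
...   | propagated _ = λ { l (there d∈m) → noDec l d∈m }

resolveConflict-step : ∀ {n} (m : Assignment n) {f : Formula n} {c} →
                       c ∈ f → ⟦ c ⟧ᶜ m ≡ F → (m ∥ f) ⟹ resolveConflict m f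
resolveConflict-step m c∈f cF with splitLastDecision m | splitLastDecision-spec m
... | nothing | noDec        = Fail , fail c∈f cF noDec
-- Matching `refl` gives the assignment the shape that `backtrack` demands.
... | just _  | refl , noDec = Backtrack , backtrack c∈f cF noDec

module _ {n : ℕ} (search : Search n) where
  open Search search

  next-state-nothing⇒final : ∀ s → next-state search s ≡ nothing → Final BaseStep s
  next-state-nothing⇒final fail    _  _ (_ , _ , ())
  next-state-nothing⇒final (m ∥ f) eq s′ (r , r∈ , step)
    with any? (λ c → ⟦ c ⟧ᶜ m ≟ᵛ F) f
  -- A conflict, or a `just` from either search, would make `eq` equate a `just` with `nothing`.
  ... | no ¬conflict
    with nothing ← findUnit m f | nothing ← findUndefined m f in noUndefined
    with step
  ...   | decide (inj₁ l∈f) lU  = findUndefined-nothing m f noUndefined _ (l∈f , lU)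
  -- The search speaks only of literals that occur, so it is applied to `~ l`.
  ...   | decide (inj₂ ~l∈f) lU =
    findUndefined-nothing m f noUndefined _ (~l∈f , ~-undefined _ m lU)
  ...   | fail c∈f cF _         = ¬conflict (lose c∈f cF)
  ...   | backtrack c∈f cF _    = ¬conflict (lose c∈f cF)
  -- UnitPropagate and Pure differ from all three rules listed in `BaseStep`.
  ...   | unitPropagate _       = contradiction r∈ λ { (there (there (there ()))) }
  ...   | pure _ _ _            = contradiction r∈ λ { (there (there (there ()))) }

  next-state-just⇒step : ∀ s s′ → next-state search s ≡ just s′ → s ⟹ s′
  next-state-just⇒step (m ∥ f) s′ eq with any? (λ c → ⟦ c ⟧ᶜ m ≟ᵛ F) f
  next-state-just⇒step (m ∥ f) _ refl | yes conflict =
    let (_ , c∈f , cF) = find conflict in resolveConflict-step m c∈f cF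
  ... | no _ with findUnit m f in unit | findUndefined m f in undefined
  next-state-just⇒step (m ∥ f) _ refl | no _ | just l | _ =
    UnitPropagate , unitPropagate (findUnit-just m f l unit)
  next-state-just⇒step (m ∥ f) _ refl | no _ | nothing | just l =
    let (l∈f , lU) = findUndefined-just m f l undefined in Decide , decide (inj₁ l∈f) lU

mainTheorem6 : (n : ℕ) (search : Search n) → IsStrategy (next-state search)
mainTheorem6 n search = record
  { next-fail    = refl
  ; next-nothing = next-state-nothing⇒final search
  ; next-just    = λ s s′ eq → [ next-state-just⇒step search s s′ eq ]
  }
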